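{- ${\sf ITL}^0_{\circ}$ is complete for the class of expanding posets, and ${\sf ITL}^{\sf FS}_{\circ}$ is complete for the class of persistent posets. That is, every $\mathcal L_{\circ}$-formula valid on all expanding posets is derivable in ${\sf ITL}^0_{\circ}$, and every $\mathcal L_{\circ}$-formula valid on all persistent posets is derivable in ${\sf ITL}^{\sf FS}_{\circ}$.
   Context: Fix a countably infinite set $\mathbb P$ of propositional variables. $\mathcal L_{\circ}$ is given by $\varphi::=\bot\mid p\mid \varphi\wedge\varphi\mid\varphi\vee\varphi\mid\varphi\to\varphi\mid{\circ}\varphi$ with $p\in\mathbb P$; $\neg\varphi:=\varphi\to\bot$. A dynamical system is $(X,\mathcal T,f)$ with $f:X\to X$ continuous; a valuation assigns open sets to formulas with $[\![\bot]\!]=\varnothing$, $[\![p]\!]$ any open set, $\wedge,\vee$ as intersection/union, $[\![\varphi\to\psi]\!]$ = interior of $(X\setminus[\![\varphi]\!])\cup[\![\psi]\!]$, $[\![{\circ}\varphi]\!]=f^{ -1}[\![\varphi]\!]$. A formula is valid on a system if $[\![\varphi]\!]=X$ for all valuations. An expanding poset is a dynamical system whose topology is the up-set topology of a partial order $\preccurlyeq$ (open sets are the upward-closed sets), so $f$ is a monotone map. A persistent poset is an expanding poset in which $f$ is moreover open, i.e. whenever $f(w)\preccurlyeq v'$ there is $w'\succcurlyeq w$ with $f(w')=v'$. ${\sf ITL}^{\sf FS}_{\circ}$ is the least set of $\mathcal L_{\circ}$-formulas containing all substitution instances of the axioms of intuitionistic propositional logic and of (N1) $\neg{\circ}\bot$;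 (N2) ${\circ}\varphi\wedge{\circ}\psi\to{\circ}(\varphi\wedge\psi)$; (N3) ${\circ}(\varphi\vee\psi)\to{\circ}\varphi\vee{\circ}\psi$; (N4) ${\circ}(\varphi\to\psi)\to({\circ}\varphi\to{\circ}\psi)$; (N5) $({\circ}\varphi\to{\circ}\psi)\to{\circ}(\varphi\to\psi)$; and closed under modus ponens and the rule from $\varphi$ infer ${\circ}\varphi$. ${\sf ITL}^0_{\circ}$ is defined in the same way but without axiom (N5). -}

module Defs where

open import Data.Nat using (ℕ)
open import Data.Empty using (⊥)
open import Data.Product using (_×_; Σ; ∃; _,_)
open import Data.Sum using (_⊎_)
open import Relation.Binary.PropositionalEquality using (_≡_)
open import Relation.Binary.Structures using (IsPartialOrder)

infixr 5 _⇒_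
infixr 6 _∨_
infixr 7 _∧_
data Fm : Set where
  ⊥'  : Fm
  var : ℕ → Fm
  _∧_ : Fm → Fm → Fm
  _∨_ : Fm → Fm → Fm
  _⇒_ : Fm → Fm → Fm
  ○   : Fm → Fm

¬' : Fm → Fm
¬' φ = φ ⇒ ⊥'

data Logic : Set where
  ITL0 ITLFS : Logic

data _⊢_ : Logic → Fm → Set where
  ax-K   : ∀ {L φ ψ} → L ⊢ (φ ⇒ ψ ⇒ φ)
  ax-S   : ∀ {L φ ψ χ} → L ⊢ ((φ ⇒ ψ ⇒ χ) ⇒ (φ ⇒ ψ) ⇒ φ ⇒ χ)
  ax-∧E₁ : ∀ {L φ ψ} → L ⊢ (φ ∧ ψ ⇒ φ)
  ax-∧E₂ : ∀ {L φ ψ} → L ⊢ (φ ∧ ψ ⇒ ψ)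
  ax-∧I  : ∀ {L φ ψ} → L ⊢ (φ ⇒ ψ ⇒ φ ∧ ψ)
  ax-∨I₁ : ∀ {L φ ψ} → L ⊢ (φ ⇒ φ ∨ ψ)
  ax-∨I₂ : ∀ {L φ ψ} → L ⊢ (ψ ⇒ φ ∨ ψ)
  ax-∨E  : ∀ {L φ ψ χ} → L ⊢ ((φ ⇒ χ) ⇒ (ψ ⇒ χ) ⇒ φ ∨ ψ ⇒ χ)
  ax-⊥E  : ∀ {L φ} → L ⊢ (⊥' ⇒ φ)
  ax-N1  : ∀ {L} → L ⊢ ¬' (○ ⊥')
  ax-N2  : ∀ {L φ ψ} → L ⊢ (○ φ ∧ ○ ψ ⇒ ○ (φ ∧ ψ))
  ax-N3  : ∀ {L φ ψ} → L ⊢ (○ (φ ∨ ψ) ⇒ ○ φ ∨ ○ ψ)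
  ax-N4  : ∀ {L φ ψ} → L ⊢ (○ (φ ⇒ ψ) ⇒ ○ φ ⇒ ○ ψ)
  ax-N5  : ∀ {φ ψ} → ITLFS ⊢ ((○ φ ⇒ ○ ψ) ⇒ ○ (φ ⇒ ψ))
  mp     : ∀ {L φ ψ} → L ⊢ (φ ⇒ ψ) → L ⊢ φ → L ⊢ ψ
  nec    : ∀ {L φ} → L ⊢ φ → L ⊢ ○ φ

-- Expanding poset: a partial order (up-set topology) with a monotone map.
record ExpandingPoset : Set₁ where
  field
    W     : Set
    _≼_   : W → W → Set
    isPO  : IsPartialOrder _≡_ _≼_
    f     : W → W
    mono  : ∀ {w v} → w ≼ v → f w ≼ f v

-- Persistent: f is moreover open.
IsPersistent : ExpandingPoset → Set
IsPersistent E = ∀ {w v'} → f w ≼ v' → Σ W λ w' → (w ≼ w') × (f w' ≡ v')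
  where open ExpandingPoset E

-- Valuations of variables: open (= upward closed) sets.
record Valuation (E : ExpandingPoset) : Set₁ where
  open ExpandingPoset E
  field
    V      : ℕ → W → Set
    upward : ∀ {p w v} → w ≼ v → V p w → V p v

-- Membership of w in [[φ]].  In the up-set topology, the interior of
-- (X ∖ A) ∪ B is {w | ∀ v ≽ w, v ∈ A → v ∈ B}.
_,_⊨_at_ : (E : ExpandingPoset) → Valuation E → Fm → ExpandingPoset.W E → Set
E , V ⊨ ⊥'    at w = ⊥
E , V ⊨ var p at w = Valuation.V V p w
E , V ⊨ φ ∧ ψ at w = (E , V ⊨ φ at w) × (E , V ⊨ ψ at w)
E , V ⊨ φ ∨ ψ at w = (E , V ⊨ φ at w) ⊎ (E , V ⊨ ψ at w)
E , V ⊨ φ ⇒ ψ at w = ∀ v → ExpandingPoset._≼_ E w v → E , V ⊨ φ at v → E , V ⊨ ψ at v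
E , V ⊨ ○ φ   at w = E , V ⊨ φ at ExpandingPoset.f E w

ValidOn : ExpandingPoset → Fm → Set₁
ValidOn E φ = (V : Valuation E) → ∀ w → E , V ⊨ φ at w

ValidExpanding : Fm → Set₁
ValidExpanding φ = (E : ExpandingPoset) → ValidOn E φ

ValidPersistent : Fm → Set₁
ValidPersistent φ = (E : ExpandingPoset) → IsPersistent E → ValidOn E φ

{-# OPTIONS --safe #-}
module Submission where

-- ITL0: worlds are sign assignments to finite universes of formulas, and f maps the assignment A to
-- {(ψ , b) | (○ ψ , b) ∈ A}.  Starting from all assignments to the closure of φ and its iterated images under f,
-- repeatedly discard the worlds that violate the truth lemma, lack a witness for a negated implication, or have
-- lost their f-image.  A discarded world is derivably inconsistent: for a missing witness by cutting over all
-- assignments, for a lost image by necessitation and N1–N4.  The survivors form a finite expanding poset with a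
-- truth lemma; if every assignment making φ false is discarded, then cutting over all assignments derives φ.
-- This decides derivability along the way, as a constructive proof must.
--
-- ITLFS: N1–N5 make ○ commute with every connective, so φ is equivalent to a formula in which ○ is applied only to
-- variables and their ○-iterates.  Such a formula cannot distinguish an expanding poset W from the persistent poset
-- W × ℕ with f (w , n) = (w , n + 1), so completeness of ITL0 applies to it.

open import Defs
open import Data.Bool using (Bool; true; false; b≤b; f≤t) renaming (_≤_ to _≤ᵇ_)
import Data.Bool.Properties as Bool
open import Data.Empty using (⊥; ⊥-elim)
open import Data.List using (List; []; _∷_; _++_; map; concatMap; length; filter; cartesianProductWith)
open import Data.List.Extrema.Nat using (max; xs≤max)
open import Data.List.Membership.Propositional using (_∈_; _∉_; find; lose)
open import Data.List.Membership.Propositional.Properties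
  using (∈-map⁺; ∈-map⁻; ∈-++⁺ˡ; ∈-++⁺ʳ; ∈-++⁻;
         ∈-concatMap⁺; ∈-concatMap⁻; ∈-cartesianProductWith⁺; ∈-filter⁺)
import Data.List.Membership.DecPropositional as DecMembership
open import Data.List.Properties using (≡-dec; filter-notAll; map-++; map-∘; map-id)
open import Data.List.Relation.Binary.Pointwise as Pointwise using (Pointwise; []; _∷_; Pointwise-≡⇒≡)
open import Data.List.Relation.Unary.All as All using (All; []; _∷_; all?)
open import Data.List.Relation.Unary.All.Properties using (¬All⇒Any¬; map⁻)
open import Data.List.Relation.Unary.Any as Any using (Any; here; there; any?)
open import Data.Nat using (ℕ; zero; suc; _<_; s≤s)
import Data.Nat.Properties as ℕ
open import Data.Nat.Induction using (<-wellFounded)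
open import Data.Product using (_×_; ∃-syntax; _,_; proj₁; proj₂)
import Data.Product.Properties as Product
open import Data.Sum using (_⊎_; inj₁; inj₂)
open import Data.Unit using (⊤; tt)
open import Function using (_∘_; _on_)
open import Function.Bundles using (mk↣)
open import Induction.WellFounded using (Acc; acc)
open import Relation.Binary.Construct.Closure.Reflexive using (ReflClosure; [_])
import Relation.Binary.Construct.Closure.Reflexive as Refl
import Relation.Binary.Construct.Closure.Reflexive.Properties as Refl
import Relation.Binary.Construct.On as On
open import Relation.Binary.Definitions using (DecidableEquality)
open import Relation.Binary.Structures using (IsPartialOrder)
open import Relation.Binary.PropositionalEquality using (_≡_; refl; sym; trans; cong; cong₂; subst; isEquivalence)
open import Relation.Nullary using (Dec; yes; no; ¬_; ¬?; _×-dec_; _⊎-dec_)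
open import Relation.Nullary.Decidable using (via-injection)
open import Relation.Unary using (Decidable)

private variable
  L : Logic
  γ δ φ ψ χ θ : Fm

-- Derived rules under a hypothesis `γ`

⇒-weaken : L ⊢ ψ → L ⊢ (γ ⇒ ψ)
⇒-weaken = mp ax-K

⇒-app : L ⊢ (γ ⇒ ψ ⇒ χ) → L ⊢ (γ ⇒ ψ) → L ⊢ (γ ⇒ χ)
⇒-app d e = mp (mp ax-S d) e

⇒-refl : L ⊢ (γ ⇒ γ)
⇒-refl {γ = γ} = ⇒-app ax-K (ax-K {ψ = γ})

⇒-trans : L ⊢ (γ ⇒ ψ) → L ⊢ (ψ ⇒ χ) → L ⊢ (γ ⇒ χ)
⇒-trans d e = ⇒-app (⇒-weaken e) d

⇒-pair : L ⊢ (γ ⇒ ψ) → L ⊢ (γ ⇒ χ) → L ⊢ (γ ⇒ ψ ∧ χ)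
⇒-pair d e = ⇒-app (⇒-trans d ax-∧I) e

⇒-curry : L ⊢ (γ ∧ ψ ⇒ χ) → L ⊢ (γ ⇒ ψ ⇒ χ)
⇒-curry d = ⇒-trans ax-∧I (mp ax-S (⇒-weaken d))

⇒-uncurry : L ⊢ (γ ⇒ ψ ⇒ χ) → L ⊢ (γ ∧ ψ ⇒ χ)
⇒-uncurry d = ⇒-app (⇒-trans ax-∧E₁ d) ax-∧E₂

⇒-case : L ⊢ (γ ⇒ ψ ⇒ θ) → L ⊢ (γ ⇒ χ ⇒ θ) → L ⊢ (γ ⇒ ψ ∨ χ ⇒ θ)
⇒-case d e = ⇒-app (⇒-trans d ax-∨E) e

○-mono : L ⊢ (φ ⇒ ψ) → L ⊢ (○ φ ⇒ ○ ψ)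
○-mono d = mp ax-N4 (nec d)

-- Decidable equality of formulas

_≟-Fm_ : DecidableEquality Fm
_≟-Fm_ = via-injection (mk↣ {to = encode} encode-injective) _≟-Tree_
  where
  -- Fm embeds in a type with two constructors, whose equality test needs few cases.
  data Tree : Set where
    leaf : ℕ → Tree
    node : ℕ → Tree → Tree → Tree

  _≟-Tree_ : DecidableEquality Tree
  leaf m     ≟-Tree leaf n       with m ℕ.≟ n
  ... | yes refl = yes refl
  ... | no m≢n   = no λ { refl → m≢n refl }
  leaf _     ≟-Tree node _ _ _   = no λ ()
  node _ _ _ ≟-Tree leaf _       = no λ ()
  node m s t ≟-Tree node n s′ t′ with m ℕ.≟ n | s ≟-Tree s′ | t ≟-Tree t′
  ... | yes refl | yes refl | yes refl = yes refl
  ... | no m≢n   | _        | _        = no λ { refl → m≢n refl }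
  ... | _        | no s≢s′  | _        = no λ { refl → s≢s′ refl }
  ... | _        | _        | no t≢t′  = no λ { refl → t≢t′ refl }

  encode : Fm → Tree
  encode ⊥'      = leaf 0
  encode (var p) = leaf (suc p)
  encode (φ ∧ ψ) = node 0 (encode φ) (encode ψ)
  encode (φ ∨ ψ) = node 1 (encode φ) (encode ψ)
  encode (φ ⇒ ψ) = node 2 (encode φ) (encode ψ)
  encode (○ φ)   = node 3 (encode φ) (leaf 0)

  decode : Tree → Fm
  decode (leaf 0)       = ⊥'
  decode (leaf (suc p)) = var p
  decode (node 0 s t)   = decode s ∧ decode t
  decode (node 1 s t)   = decode s ∨ decode t
  decode (node 2 s t)   = decode s ⇒ decode t
  decode (node _ s t)   = ○ (decode s)

  decode-encode : ∀ φ → decode (encode φ) ≡ φ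
  decode-encode ⊥'      = refl
  decode-encode (var p) = refl
  decode-encode (φ ∧ ψ) = cong₂ _∧_ (decode-encode φ) (decode-encode ψ)
  decode-encode (φ ∨ ψ) = cong₂ _∨_ (decode-encode φ) (decode-encode ψ)
  decode-encode (φ ⇒ ψ) = cong₂ _⇒_ (decode-encode φ) (decode-encode ψ)
  decode-encode (○ φ)   = cong ○ (decode-encode φ)

  encode-injective : ∀ {φ ψ} → encode φ ≡ encode ψ → φ ≡ ψ
  encode-injective {φ} {ψ} eq = trans (sym (decode-encode φ)) (trans (cong decode eq) (decode-encode ψ))

-- Universes of formulas

under : Fm → List Fm
under (○ ψ) = ψ ∷ []
under _     = []

∈-under : ∀ φ → ψ ∈ under φ → φ ≡ ○ ψ
∈-under (○ _) (here refl) = refl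

unbox : List Fm → List Fm
unbox = concatMap under

unbox⁻ : ∀ {U} → ψ ∈ unbox U → ○ ψ ∈ U
unbox⁻ = Any.map (λ {φ} m → sym (∈-under φ m)) ∘ ∈-concatMap⁻ under

○^ : ℕ → Fm → Fm
○^ zero    φ = φ
○^ (suc n) φ = ○ (○^ n φ)

Parts : (Fm → Set) → Fm → Set
Parts P ⊥'      = ⊤
Parts P (var _) = ⊤
Parts P (φ ∧ ψ) = P φ × P ψ
Parts P (φ ∨ ψ) = P φ × P ψ
Parts P (φ ⇒ ψ) = P φ × P ψ
Parts P (○ _)   = ⊤

Parts-map : ∀ {P Q : Fm → Set} → (∀ {χ} → P χ → Q χ) → ∀ φ → Parts P φ → Parts Q φ
Parts-map f ⊥'      _       = tt
Parts-map f (var _) _       = tt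
Parts-map f (_ ∧ _) (p , q) = f p , f q
Parts-map f (_ ∨ _) (p , q) = f p , f q
Parts-map f (_ ⇒ _) (p , q) = f p , f q
Parts-map f (○ _)   _       = tt

-- The exponent j makes closedness survive unboxing.
Closed : List Fm → Set
Closed U = ∀ j ψ → ○^ j ψ ∈ U → Parts (λ χ → ○^ j χ ∈ U) ψ

unbox-closed : ∀ {U} → Closed U → Closed (unbox U)
unbox-closed c j ψ m = Parts-map (∈-concatMap⁺ under ∘ Any.map λ { refl → here refl }) ψ (c (suc j) ψ (unbox⁻ m))

-- The clause for `○` prefixes every member with `○` instead of adding `closure φ` itself: what lies
-- below a `○` matters only after a step, where `unbox` brings it back.
closure : Fm → List Fm
closure ⊥'      = ⊥' ∷ []
closure (var p) = var p ∷ []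
closure (φ ∧ ψ) = φ ∧ ψ ∷ closure φ ++ closure ψ
closure (φ ∨ ψ) = φ ∨ ψ ∷ closure φ ++ closure ψ
closure (φ ⇒ ψ) = (φ ⇒ ψ) ∷ closure φ ++ closure ψ
closure (○ φ)   = map ○ (closure φ)

φ∈closure : ∀ φ → φ ∈ closure φ
φ∈closure ⊥'      = here refl
φ∈closure (var p) = here refl
φ∈closure (φ ∧ ψ) = here refl
φ∈closure (φ ∨ ψ) = here refl
φ∈closure (φ ⇒ ψ) = here refl
φ∈closure (○ φ)   = ∈-map⁺ ○ (φ∈closure φ)

++-closed : ∀ {U V} → Closed U → Closed V → Closed (U ++ V)
++-closed {U} c d j ψ m with ∈-++⁻ U m
... | inj₁ m′ = Parts-map ∈-++⁺ˡ ψ (c j ψ m′)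
... | inj₂ m′ = Parts-map (∈-++⁺ʳ U) ψ (d j ψ m′)

∷-closed : ∀ {U} → Closed U → under φ ≡ [] → Parts (_∈ U) φ → Closed (φ ∷ U)
∷-closed c e p zero    ψ (here refl) = Parts-map there ψ p
∷-closed c () p (suc j) ψ (here refl)
∷-closed c e p j       ψ (there m)   = Parts-map there ψ (c j ψ m)

closure-closed : ∀ φ → Closed (closure φ)
closure-closed ⊥'      = ∷-closed (λ _ _ ()) refl tt
closure-closed (var p) = ∷-closed (λ _ _ ()) refl tt
closure-closed (φ ∧ ψ) = ∷-closed (++-closed (closure-closed φ) (closure-closed ψ)) refl
  (∈-++⁺ˡ (φ∈closure φ) , ∈-++⁺ʳ (closure φ) (φ∈closure ψ))
closure-closed (φ ∨ ψ) = ∷-closed (++-closed (closure-closed φ) (closure-closed ψ)) refl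
  (∈-++⁺ˡ (φ∈closure φ) , ∈-++⁺ʳ (closure φ) (φ∈closure ψ))
closure-closed (φ ⇒ ψ) = ∷-closed (++-closed (closure-closed φ) (closure-closed ψ)) refl
  (∈-++⁺ˡ (φ∈closure φ) , ∈-++⁺ʳ (closure φ) (φ∈closure ψ))
closure-closed (○ φ) j ψ m with ∈-map⁻ ○ m
closure-closed (○ φ) zero    _ m | _ , _  , refl = tt
closure-closed (○ φ) (suc j) ψ m | _ , m′ , refl = Parts-map (∈-map⁺ ○) ψ (closure-closed φ j ψ m′)

boxes : Fm → ℕ
boxes (○ φ) = suc (boxes φ)
boxes _     = 0

layers : ℕ → List Fm → List (List Fm)
layers zero    U = U ∷ []
layers (suc n) U = U ∷ layers n (unbox U)

U∈layers : ∀ n {U} → U ∈ layers n U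
U∈layers zero    = here refl
U∈layers (suc n) = here refl

unbox-boxes : ∀ {U n} → All (λ ψ → boxes ψ < suc n) U → All (λ ψ → boxes ψ < n) (unbox U)
unbox-boxes b = All.tabulate λ m → ℕ.≤-pred (All.lookup b (unbox⁻ m))

-- Each unboxing strips a leading `○`, so under the bound the last layer is empty, and `unbox` fixes
-- the empty universe.
layers-unbox : ∀ n {U V} → All (λ ψ → boxes ψ < n) U → V ∈ layers n U → unbox V ∈ layers n U
layers-unbox zero    []      (here refl) = here refl
layers-unbox (suc n) b       (here refl) = there (U∈layers n)
layers-unbox (suc n) b       (there m)   = there (layers-unbox n (unbox-boxes b) m)

layers-closed : ∀ n {U V} → Closed U → V ∈ layers n U → Closed V
layers-closed zero    c (here refl) = c
layers-closed (suc n) c (here refl) = c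
layers-closed (suc n) c (there m)   = layers-closed n (unbox-closed c) m

boxes-bound : ∀ U → ∃[ n ] All (λ ψ → boxes ψ < n) U
boxes-bound U = suc (max 0 (map boxes U)) , All.map s≤s (map⁻ (xs≤max 0 (map boxes U)))

-- Signed universes

Signed : Set
Signed = Fm × Bool

World : Set
World = List Signed

universe : World → List Fm
universe = map proj₁

private variable
  A B : World

_≟-Signed_ : DecidableEquality Signed
_≟-Signed_ = Product.≡-dec _≟-Fm_ Bool._≟_

open DecMembership _≟-Signed_ using () renaming (_∈?_ to _∈ˢ?_)
open DecMembership (≡-dec _≟-Signed_) using () renaming (_∈?_ to _∈ʷ?_)

sign : φ ∈ universe A → (φ , true) ∈ A ⊎ (φ , false) ∈ A
sign {A = A} m with ∈-map⁻ proj₁ m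
... | (_ , true)  , m′ , refl = inj₁ m′
... | (_ , false) , m′ , refl = inj₂ m′

assignments : List Fm → List World
assignments []      = [] ∷ []
assignments (φ ∷ U) = cartesianProductWith _∷_ (map (φ ,_) (true ∷ false ∷ [])) (assignments U)

∈-assignments : ∀ A → A ∈ assignments (universe A)
∈-assignments []            = here refl
∈-assignments ((φ , b) ∷ A) =
  ∈-cartesianProductWith⁺ _∷_ {xs = map (φ ,_) (true ∷ false ∷ [])} (∈-map⁺ (φ ,_) (∈-bools b)) (∈-assignments A)
  where
  ∈-bools : ∀ b → b ∈ true ∷ false ∷ []
  ∈-bools true  = here refl
  ∈-bools false = there (here refl)

underˢ : Signed → World
underˢ (φ , b) = map (_, b) (under φ)

step : World → World
step = concatMap underˢ

step⁺ : ∀ {b} → (○ φ , b) ∈ A → (φ , b) ∈ step A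
step⁺ = ∈-concatMap⁺ underˢ ∘ Any.map λ { refl → here refl }

step⁻ : ∀ {b} → (φ , b) ∈ step A → (○ φ , b) ∈ A
step⁻ = Any.map inv ∘ ∈-concatMap⁻ underˢ
  where
  inv : ∀ {s : Signed} {b} → (φ , b) ∈ underˢ s → (○ φ , b) ≡ s
  inv {s = ψ , b} m with ∈-map⁻ (_, b) m
  ... | _ , m′ , refl = cong (_, b) (sym (∈-under ψ m′))

universe-step : ∀ A → universe (step A) ≡ unbox (universe A)
universe-step []            = refl
universe-step ((φ , b) ∷ A) = trans (map-++ proj₁ (underˢ (φ , b)) (step A))
  (cong₂ _++_ (trans (sym (map-∘ (under φ))) (map-id (under φ))) (universe-step A))

infix 4 _≤ˢ_ _⊑_
_≤ˢ_ : Signed → Signed → Set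
(φ , b) ≤ˢ (ψ , c) = φ ≡ ψ × b ≤ᵇ c

-- Comparing position by position keeps the order antisymmetric even when a universe repeats a
-- formula; inclusion of the true parts would not.
_⊑_ : World → World → Set
_⊑_ = Pointwise _≤ˢ_

_⊑?_ : ∀ A B → Dec (A ⊑ B)
_⊑?_ = Pointwise.decidable λ (φ , b) (ψ , c) → (φ ≟-Fm ψ) ×-dec (b Bool.≤? c)

⊑-trans : ∀ {C} → A ⊑ B → B ⊑ C → A ⊑ C
⊑-trans = Pointwise.transitive λ (e , l) (e′ , l′) → trans e e′ , Bool.≤-trans l l′

⊑-antisym : A ⊑ B → B ⊑ A → A ≡ B
⊑-antisym p q = Pointwise-≡⇒≡ (Pointwise.antisymmetric (λ (e , l) (_ , l′) → cong₂ _,_ e (Bool.≤-antisym l l′)) p q)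

⊑-true : A ⊑ B → (φ , true) ∈ A → (φ , true) ∈ B
⊑-true ((refl , b≤b) ∷ _) (here refl) = here refl
⊑-true (_ ∷ p)            (there m)   = there (⊑-true p m)

⊑-step : A ⊑ B → step A ⊑ step B
⊑-step [] = []
⊑-step {(φ , _) ∷ _} ((refl , l) ∷ p) =
  Pointwise.++⁺ (Pointwise.map⁺ _ _ (Pointwise.refl (refl , l) {under φ})) (⊑-step p)

-- The clash serves to refute `B` as a world above `A`: a context deriving the true part of `A`
-- derives a formula that `B` makes false.
⊑-or-clash : ∀ A B → universe B ≡ universe A → A ⊑ B ⊎ ∃[ φ ] (φ , true) ∈ A × (φ , false) ∈ B
⊑-or-clash [] [] _ = inj₁ []
⊑-or-clash ((φ , b) ∷ A) ((ψ , c) ∷ B) eq with cong (λ { [] → φ ; (χ ∷ _) → χ }) eq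
... | refl with ⊑-or-clash A B (cong (λ { [] → [] ; (_ ∷ U) → U }) eq)
...   | inj₂ (χ , m , m′) = inj₂ (χ , there m , there m′)
...   | inj₁ p with b | c
...     | true  | false = inj₂ (φ , here refl , here refl)
...     | true  | true  = inj₁ ((refl , b≤b) ∷ p)
...     | false | true  = inj₁ ((refl , f≤t) ∷ p)
...     | false | false = inj₁ ((refl , b≤b) ∷ p)

-- Inconsistent worlds

infix 4 _⊩_
_⊩_ : Fm → Fm → Set
γ ⊩ ψ = ITL0 ⊢ (γ ⇒ ψ)

-- A world is read as a sequent, true formulas on the left and false ones on the right; `γ` and `θ`
-- are arbitrary bounds in place of the conjunction and the disjunction.
Realises : Fm → Fm → Signed → Set
Realises γ θ (ψ , true)  = γ ⊩ ψ
Realises γ θ (ψ , false) = γ ⊩ (ψ ⇒ θ)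

-- Equivalent to the derivability of ⋀ {ψ | (ψ , true) ∈ A} ⇒ ⋁ {ψ | (ψ , false) ∈ A}.
Inconsistent : World → Set
Inconsistent A = ∀ {γ θ} → All (Realises γ θ) A → γ ⊩ θ

Realises-weaken : δ ⊩ γ → ∀ {s} → Realises γ θ s → Realises δ θ s
Realises-weaken d {_ , true}  r = ⇒-trans d r
Realises-weaken d {_ , false} r = ⇒-trans d r

Realises-mono : θ ⊩ χ → ∀ {s} → Realises γ θ s → Realises γ χ s
Realises-mono d {_ , true}  r = r
Realises-mono d {_ , false} r = ⇒-app (⇒-app (⇒-weaken ax-S) (⇒-weaken (⇒-weaken d))) r

-- Let `π` be the conjunction of the true members of `step A` and `ν` the disjunction of the false
-- ones. Inconsistency gives `π ⊩ ν`, hence `○ π ⊩ ○ ν`; N2 assembles `○ π` from `γ`, while N3 and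
-- N1 take `○ ν` apart into `θ`.
step-inconsistent : Inconsistent (step A) → Inconsistent A
step-inconsistent {A} inc {γ} {θ} r
  with interpolate (step A) (All.tabulate λ {s} m → boxed {s} m)
  where
  Boxed : Signed → Set
  Boxed (ψ , b) = Realises γ θ (○ ψ , b)

  boxed : ∀ {s} → s ∈ step A → Boxed s
  boxed m = All.lookup r (step⁻ m)

  interpolate : ∀ C → All Boxed C → ∃[ π ] ∃[ ν ] All (Realises π ν) C × γ ⊩ ○ π × γ ⊩ (○ ν ⇒ θ)
  interpolate [] [] =
    (⊥' ⇒ ⊥') , ⊥' , [] , ⇒-weaken (nec ⇒-refl) , ⇒-weaken (⇒-trans ax-N1 ax-⊥E)
  interpolate ((ψ , true) ∷ C) (b ∷ bs) with interpolate C bs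
  ... | π , ν , rs , p , n =
    ψ ∧ π , ν , ax-∧E₁ ∷ All.map (λ {s} → Realises-weaken ax-∧E₂ {s}) rs , ⇒-trans (⇒-pair b p) ax-N2 , n
  interpolate ((ψ , false) ∷ C) (b ∷ bs) with interpolate C bs
  ... | π , ν , rs , p , n =
    π , ψ ∨ ν , ⇒-weaken ax-∨I₁ ∷ All.map (λ {s} → Realises-mono ax-∨I₂ {s}) rs , p
    , ⇒-curry (⇒-trans (⇒-pair ax-∧E₁ (⇒-trans ax-∧E₂ ax-N3)) (⇒-uncurry (⇒-case b n)))
... | π , ν , rs , p , n = ⇒-app n (⇒-trans p (○-mono (inc rs)))

-- Cut on each formula of U in turn.
by-assignments : ∀ U → (∀ B → universe B ≡ U → ∀ {δ} → δ ⊩ γ → All (Realises δ θ) B → δ ⊩ θ) → γ ⊩ θ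
by-assignments []      k = k [] refl ⇒-refl []
by-assignments {γ} {θ} (φ ∷ U) k =
  by-assignments U λ B e d r → k ((φ , false) ∷ B) (cong (φ ∷_) e) d (⇒-trans d φ-case ∷ r)
  where
  φ-case : γ ⊩ (φ ⇒ θ)
  φ-case = ⇒-curry (by-assignments U λ B e d r →
    k ((φ , true) ∷ B) (cong (φ ∷_) e) (⇒-trans d ax-∧E₁) (⇒-trans d ax-∧E₂ ∷ r))

-- Elimination of defective worlds

IsWitness : Fm → Fm → World → World → Set
IsWitness φ ψ A B = A ⊑ B × (φ , true) ∈ B × (ψ , false) ∈ B

-- A true implication is tested at `A` alone: it persists to every world above, which is tested in
-- turn. For `○` the work is done by `step A ∈ 𝒲` in `Good`.
Sound : List World → World → Signed → Set
Sound 𝒲 A (⊥'    , true)  = ⊥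
Sound 𝒲 A (⊥'    , false) = ⊤
Sound 𝒲 A (var p , true)  = ⊤
-- A universe may repeat a formula, so a world may give it both signs. This is excluded here for
-- variables; for compound formulas the truth lemma excludes it.
Sound 𝒲 A (var p , false) = (var p , true) ∉ A
Sound 𝒲 A (φ ∧ ψ , true)  = (φ , true) ∈ A × (ψ , true) ∈ A
Sound 𝒲 A (φ ∧ ψ , false) = (φ , false) ∈ A ⊎ (ψ , false) ∈ A
Sound 𝒲 A (φ ∨ ψ , true)  = (φ , true) ∈ A ⊎ (ψ , true) ∈ A
Sound 𝒲 A (φ ∨ ψ , false) = (φ , false) ∈ A × (ψ , false) ∈ A
Sound 𝒲 A (φ ⇒ ψ , true)  = (φ , false) ∈ A ⊎ (ψ , true) ∈ A
Sound 𝒲 A (φ ⇒ ψ , false) = Any (IsWitness φ ψ A) 𝒲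
Sound 𝒲 A (○ φ   , _)     = ⊤

Good : List World → World → Set
Good 𝒲 A = step A ∈ 𝒲 × All (Sound 𝒲 A) A

sound? : ∀ 𝒲 A → Decidable (Sound 𝒲 A)
sound? 𝒲 A (⊥'    , true)  = no λ ()
sound? 𝒲 A (⊥'    , false) = yes tt
sound? 𝒲 A (var p , true)  = yes tt
sound? 𝒲 A (var p , false) = ¬? (_ ∈ˢ? A)
sound? 𝒲 A (φ ∧ ψ , true)  = (_ ∈ˢ? A) ×-dec (_ ∈ˢ? A)
sound? 𝒲 A (φ ∧ ψ , false) = (_ ∈ˢ? A) ⊎-dec (_ ∈ˢ? A)
sound? 𝒲 A (φ ∨ ψ , true)  = (_ ∈ˢ? A) ⊎-dec (_ ∈ˢ? A)
sound? 𝒲 A (φ ∨ ψ , false) = (_ ∈ˢ? A) ×-dec (_ ∈ˢ? A)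
sound? 𝒲 A (φ ⇒ ψ , true)  = (_ ∈ˢ? A) ⊎-dec (_ ∈ˢ? A)
sound? 𝒲 A (φ ⇒ ψ , false) = any? (λ B → (A ⊑? B) ×-dec ((_ ∈ˢ? B) ×-dec (_ ∈ˢ? B))) 𝒲
sound? 𝒲 A (○ φ   , _)     = yes tt

good? : ∀ 𝒲 → Decidable (Good 𝒲)
good? 𝒲 A = (step A ∈ʷ? 𝒲) ×-dec all? (sound? 𝒲 A) A

module Elimination
  (𝒰 : List (List Fm))
  (𝒰-unbox  : ∀ {U} → U ∈ 𝒰 → unbox U ∈ 𝒰)
  (𝒰-closed : ∀ {U} → U ∈ 𝒰 → Closed U)
  where

  Candidate : World → Set
  Candidate A = universe A ∈ 𝒰

  Exhaustive : List World → Set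
  Exhaustive 𝒲 = ∀ {A} → Candidate A → A ∉ 𝒲 → Inconsistent A

  unsound-inconsistent : ∀ {𝒲} → Exhaustive 𝒲 → Candidate A → ∀ s → s ∈ A → ¬ Sound 𝒲 A s → Inconsistent A
  unsound-inconsistent {A} {𝒲} exh cand (φ , b) m ¬s {γ} {θ} r = refute φ b m (𝒰-closed cand 0 φ (∈-map⁺ proj₁ m)) ¬s
    where
    refute : ∀ φ b → (φ , b) ∈ A → Parts (_∈ universe A) φ → ¬ Sound 𝒲 A (φ , b) → γ ⊩ θ
    refute ⊥' true  m _ ¬s = ⇒-trans (All.lookup r m) ax-⊥E
    refute ⊥' false m _ ¬s = ⊥-elim (¬s tt)
    refute (var p) true  m _ ¬s = ⊥-elim (¬s tt)
    refute (var p) false m _ ¬s with (var p , true) ∈ˢ? A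
    ... | yes m⁺ = ⇒-app (All.lookup r m) (All.lookup r m⁺)
    ... | no ¬m⁺ = ⊥-elim (¬s ¬m⁺)
    refute (φ ∧ ψ) true  m (p , q) ¬s with sign p | sign q
    ... | inj₁ x | inj₁ y = ⊥-elim (¬s (x , y))
    ... | inj₂ x | _      = ⇒-app (All.lookup r x) (⇒-trans (All.lookup r m) ax-∧E₁)
    ... | _      | inj₂ y = ⇒-app (All.lookup r y) (⇒-trans (All.lookup r m) ax-∧E₂)
    refute (φ ∧ ψ) false m (p , q) ¬s with sign p | sign q
    ... | inj₁ x | inj₁ y = ⇒-app (All.lookup r m) (⇒-pair (All.lookup r x) (All.lookup r y))
    ... | inj₂ x | _      = ⊥-elim (¬s (inj₁ x))
    ... | _      | inj₂ y = ⊥-elim (¬s (inj₂ y))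
    refute (φ ∨ ψ) true  m (p , q) ¬s with sign p | sign q
    ... | inj₂ x | inj₂ y = ⇒-app (⇒-case (All.lookup r x) (All.lookup r y)) (All.lookup r m)
    ... | inj₁ x | _      = ⊥-elim (¬s (inj₁ x))
    ... | _      | inj₁ y = ⊥-elim (¬s (inj₂ y))
    refute (φ ∨ ψ) false m (p , q) ¬s with sign p | sign q
    ... | inj₂ x | inj₂ y = ⊥-elim (¬s (x , y))
    ... | inj₁ x | _      = ⇒-app (All.lookup r m) (⇒-trans (All.lookup r x) ax-∨I₁)
    ... | _      | inj₁ y = ⇒-app (All.lookup r m) (⇒-trans (All.lookup r y) ax-∨I₂)
    refute (φ ⇒ ψ) true  m (p , q) ¬s with sign p | sign q
    ... | inj₁ x | inj₂ y = ⇒-app (All.lookup r y) (⇒-app (All.lookup r m) (All.lookup r x))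
    ... | inj₂ x | _      = ⊥-elim (¬s (inj₁ x))
    ... | _      | inj₁ y = ⊥-elim (¬s (inj₂ y))
    -- It suffices that `γ ∧ φ` derives `ψ`; only the true part of `A` carries over to this goal.
    -- Cut over all `B` on the universe of `A`: a wrong sign at `φ` or `ψ`, or a clash with `A`,
    -- closes the case, and any other `B` would be a witness, so it is missing from `𝒲` and hence
    -- inconsistent.
    refute (φ ⇒ ψ) false m (p , q) ¬s =
      ⇒-app (All.lookup r m) (⇒-curry (by-assignments (universe A) no-witness))
      where
      no-witness : ∀ B → universe B ≡ universe A → ∀ {δ} → δ ⊩ (γ ∧ φ) → All (Realises δ ψ) B → δ ⊩ ψ
      no-witness B e d rB with sign (subst (φ ∈_) (sym e) p) | sign (subst (ψ ∈_) (sym e) q)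
      ... | inj₂ x | _      = ⇒-app (All.lookup rB x) (⇒-trans d ax-∧E₂)
      ... | inj₁ _ | inj₁ y = All.lookup rB y
      ... | inj₁ x | inj₂ y with ⊑-or-clash A B e
      ...   | inj₂ (_ , u , v) = ⇒-app (All.lookup rB v) (⇒-trans d (⇒-trans ax-∧E₁ (All.lookup r u)))
      ...   | inj₁ A⊑B with B ∈ʷ? 𝒲
      ...     | yes B∈𝒲 = ⊥-elim (¬s (lose B∈𝒲 (A⊑B , x , y)))
      ...     | no  B∉𝒲 = exh (subst (_∈ 𝒰) (sym e) cand) B∉𝒲 rB
    refute (○ φ) b m _ ¬s = ⊥-elim (¬s tt)

  defective-inconsistent : ∀ {𝒲} → Exhaustive 𝒲 → Candidate A → ¬ Good 𝒲 A → Inconsistent A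
  defective-inconsistent {A} {𝒲} exh cand ¬good with step A ∈ʷ? 𝒲
  ... | no  sA∉𝒲 =
    step-inconsistent (exh (subst (_∈ 𝒰) (sym (universe-step A)) (𝒰-unbox cand)) sA∉𝒲)
  ... | yes sA∈𝒲 with find (¬All⇒Any¬ (sound? 𝒲 A) A (λ all → ¬good (sA∈𝒲 , all)))
  ...   | s , m , ¬s = unsound-inconsistent exh cand s m ¬s

  -- Discarding worlds can remove the witnesses or images of others, so goodness is tested again
  -- against the shorter list until nothing changes.
  eliminate : ∀ 𝒲 → Acc (_<_ on length) 𝒲 → Exhaustive 𝒲 → ∃[ 𝒲′ ] All (Good 𝒲′) 𝒲′ × Exhaustive 𝒲′
  eliminate 𝒲 (acc rec) exh with all? (good? 𝒲) 𝒲
  ... | yes good  = 𝒲 , good , exh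
  ... | no  ¬good = eliminate (filter (good? 𝒲) 𝒲)
      (rec (filter-notAll (good? 𝒲) 𝒲 (¬All⇒Any¬ (good? 𝒲) 𝒲 ¬good))) exh′
    where
    exh′ : Exhaustive (filter (good? 𝒲) 𝒲)
    exh′ {A} cand A∉ with good? 𝒲 A | A ∈ʷ? 𝒲
    ... | no ¬gA | _       = defective-inconsistent exh cand ¬gA
    ... | yes _  | no  A∉𝒲 = exh cand A∉𝒲
    ... | yes gA | yes A∈𝒲 = ⊥-elim (A∉ (∈-filter⁺ (good? 𝒲) A∈𝒲 gA))

  good-worlds : ∃[ 𝒲 ] All (Good 𝒲) 𝒲 × Exhaustive 𝒲
  good-worlds = eliminate (concatMap assignments 𝒰) (On.wellFounded length <-wellFounded _)
    λ {A} cand A∉ → ⊥-elim (A∉ (∈-concatMap⁺ assignments (lose cand (∈-assignments A))))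

-- Model of the surviving worlds and completeness of `ITL0`

module CanonicalModel
  (𝒲 : List World) (𝒲-good : ∀ {A} → A ∈ 𝒲 → Good 𝒲 A)
  where

  -- Restricting the order rather than the carrier avoids points paired with membership proofs:
  -- worlds outside `𝒲` become isolated points of the model.
  _⊑ᵍ_ : World → World → Set
  A ⊑ᵍ B = A ∈ 𝒲 × B ∈ 𝒲 × A ⊑ B

  model : ExpandingPoset
  model = record
    { W    = World
    ; _≼_  = ReflClosure _⊑ᵍ_
    ; isPO = record
      { isPreorder = Refl.isPreorder λ (a , _ , p) (_ , c , q) → a , c , ⊑-trans p q
      ; antisym    = λ { Refl.refl _ → refl ; _ Refl.refl → refl
                      ; [ _ , _ , p ] [ _ , _ , q ] → ⊑-antisym p q }
      }
    ; f    = step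
    ; mono = Refl.map λ (a , b , p) → proj₁ (𝒲-good a) , proj₁ (𝒲-good b) , ⊑-step p
    }

  valuation : Valuation model
  valuation = record
    { V      = λ p A → (var p , true) ∈ A
    ; upward = λ { Refl.refl m → m ; [ _ , _ , p ] m → ⊑-true p m }
    }

  -- The two halves need each other because an implication reverses the sign of its antecedent.
  truth⁺ : ∀ φ → A ∈ 𝒲 → (φ , true) ∈ A → model , valuation ⊨ φ at A
  truth⁻ : ∀ φ → A ∈ 𝒲 → (φ , false) ∈ A → ¬ (model , valuation ⊨ φ at A)

  sound : A ∈ 𝒲 → ∀ {s} → s ∈ A → Sound 𝒲 A s
  sound a = All.lookup (proj₂ (𝒲-good a))

  truth⁺ ⊥'      a m = sound a m
  truth⁺ (var p) a m = m
  truth⁺ (φ ∧ ψ) a m = truth⁺ φ a (proj₁ (sound a m)) , truth⁺ ψ a (proj₂ (sound a m))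
  truth⁺ (φ ∨ ψ) a m with sound a m
  ... | inj₁ x = inj₁ (truth⁺ φ a x)
  ... | inj₂ y = inj₂ (truth⁺ ψ a y)
  truth⁺ (φ ⇒ ψ) a m B A≼B ⊨φ with persist A≼B
    where
    persist : ∀ {B} → ReflClosure _⊑ᵍ_ _ B → B ∈ 𝒲 × (φ ⇒ ψ , true) ∈ B
    persist Refl.refl       = a , m
    persist [ _ , b , A⊑B ] = b , ⊑-true A⊑B m
  ... | b , m′ with sound b m′
  ...   | inj₁ x = ⊥-elim (truth⁻ φ b x ⊨φ)
  ...   | inj₂ y = truth⁺ ψ b y
  truth⁺ (○ φ)   a m = truth⁺ φ (proj₁ (𝒲-good a)) (step⁺ m)

  truth⁻ ⊥'      a m ()
  truth⁻ (var p) a m = sound a m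
  truth⁻ (φ ∧ ψ) a m (⊨φ , ⊨ψ) with sound a m
  ... | inj₁ x = truth⁻ φ a x ⊨φ
  ... | inj₂ y = truth⁻ ψ a y ⊨ψ
  truth⁻ (φ ∨ ψ) a m (inj₁ ⊨φ) = truth⁻ φ a (proj₁ (sound a m)) ⊨φ
  truth⁻ (φ ∨ ψ) a m (inj₂ ⊨ψ) = truth⁻ ψ a (proj₂ (sound a m)) ⊨ψ
  truth⁻ (φ ⇒ ψ) a m ⊨⇒ with find (sound a m)
  ... | B , b , A⊑B , x , y = truth⁻ ψ b y (⊨⇒ B [ a , b , A⊑B ] (truth⁺ φ b x))
  truth⁻ (○ φ)   a m = truth⁻ φ (proj₁ (𝒲-good a)) (step⁺ m)

completeness-ITL0 : ∀ φ → ValidExpanding φ → ITL0 ⊢ φ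
completeness-ITL0 φ valid with boxes-bound (closure φ)
-- The cut starts from the derivable `⊥' ⇒ ⊥'` as an empty context.
... | n , bound = mp (by-assignments (closure φ) refute) ⇒-refl
  where
  open Elimination (layers n (closure φ)) (layers-unbox n bound) (layers-closed n (closure-closed φ))

  𝒲 : List World
  𝒲 = proj₁ good-worlds

  open CanonicalModel 𝒲 (All.lookup (proj₁ (proj₂ good-worlds)))

  refute : ∀ B → universe B ≡ closure φ → ∀ {δ} → δ ⊩ (⊥' ⇒ ⊥') → All (Realises δ φ) B → δ ⊩ φ
  refute B e _ r with sign (subst (φ ∈_) (sym e) (φ∈closure φ))
  ... | inj₁ m = All.lookup r m
  ... | inj₂ m with B ∈ʷ? 𝒲
  ...   | yes B∈𝒲 = ⊥-elim (truth⁻ φ B∈𝒲 m (valid model valuation B))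
  ...   | no  B∉𝒲 = proj₂ (proj₂ good-worlds) (subst (_∈ _) (sym e) (U∈layers n)) B∉𝒲 r

-- Persistent posets

-- The normal form of `○^ n φ`: `n` counts the `○` collected on the way down to the variables.
pushed : ℕ → Fm → Fm
pushed n ⊥'      = ⊥'
pushed n (var p) = ○^ n (var p)
pushed n (φ ∧ ψ) = pushed n φ ∧ pushed n ψ
pushed n (φ ∨ ψ) = pushed n φ ∨ pushed n ψ
pushed n (φ ⇒ ψ) = pushed n φ ⇒ pushed n ψ
pushed n (○ φ)   = pushed (suc n) φ

infix 4 _⊣⊢_
_⊣⊢_ : Fm → Fm → Set
φ ⊣⊢ ψ = ITLFS ⊢ (φ ⇒ ψ) × ITLFS ⊢ (ψ ⇒ φ)

⊣⊢-trans : φ ⊣⊢ ψ → ψ ⊣⊢ χ → φ ⊣⊢ χ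
⊣⊢-trans (d , e) (d′ , e′) = ⇒-trans d d′ , ⇒-trans e′ e

∧-mono : L ⊢ (φ ⇒ ψ) → L ⊢ (χ ⇒ θ) → L ⊢ (φ ∧ χ ⇒ ψ ∧ θ)
∧-mono d e = ⇒-pair (⇒-trans ax-∧E₁ d) (⇒-trans ax-∧E₂ e)

∨-mono : L ⊢ (φ ⇒ ψ) → L ⊢ (χ ⇒ θ) → L ⊢ (φ ∨ χ ⇒ ψ ∨ θ)
∨-mono d e = mp (mp ax-∨E (⇒-trans d ax-∨I₁)) (⇒-trans e ax-∨I₂)

⇒-mono : L ⊢ (ψ ⇒ φ) → L ⊢ (χ ⇒ θ) → L ⊢ ((φ ⇒ χ) ⇒ ψ ⇒ θ)
⇒-mono d e = ⇒-curry (⇒-trans (⇒-app ax-∧E₁ (⇒-trans ax-∧E₂ d)) e)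

∧-cong : φ ⊣⊢ ψ → χ ⊣⊢ θ → φ ∧ χ ⊣⊢ ψ ∧ θ
∧-cong (d , e) (d′ , e′) = ∧-mono d d′ , ∧-mono e e′

∨-cong : φ ⊣⊢ ψ → χ ⊣⊢ θ → φ ∨ χ ⊣⊢ ψ ∨ θ
∨-cong (d , e) (d′ , e′) = ∨-mono d d′ , ∨-mono e e′

⇒-cong : φ ⊣⊢ ψ → χ ⊣⊢ θ → (φ ⇒ χ) ⊣⊢ (ψ ⇒ θ)
⇒-cong (d , e) (d′ , e′) = ⇒-mono e d′ , ⇒-mono d e′

○-cong : φ ⊣⊢ ψ → ○ φ ⊣⊢ ○ ψ
○-cong (d , e) = ○-mono d , ○-mono e

○-⊥ : ○ ⊥' ⊣⊢ ⊥'
○-⊥ = ax-N1 , ax-⊥E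

○-∧ : ○ (φ ∧ ψ) ⊣⊢ ○ φ ∧ ○ ψ
○-∧ = ⇒-pair (○-mono ax-∧E₁) (○-mono ax-∧E₂) , ax-N2

○-∨ : ○ (φ ∨ ψ) ⊣⊢ ○ φ ∨ ○ ψ
○-∨ = ax-N3 , mp (mp ax-∨E (○-mono ax-∨I₁)) (○-mono ax-∨I₂)

-- The one place where N5 enters.
○-⇒ : ○ (φ ⇒ ψ) ⊣⊢ (○ φ ⇒ ○ ψ)
○-⇒ = ax-N4 , ax-N5

○-pushed : ∀ n φ → ○ (pushed n φ) ⊣⊢ pushed (suc n) φ
○-pushed n ⊥'      = ○-⊥
○-pushed n (var p) = ⇒-refl , ⇒-refl
○-pushed n (φ ∧ ψ) = ⊣⊢-trans ○-∧ (∧-cong (○-pushed n φ) (○-pushed n ψ))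
○-pushed n (φ ∨ ψ) = ⊣⊢-trans ○-∨ (∨-cong (○-pushed n φ) (○-pushed n ψ))
○-pushed n (φ ⇒ ψ) = ⊣⊢-trans ○-⇒ (⇒-cong (○-pushed n φ) (○-pushed n ψ))
○-pushed n (○ φ)   = ○-pushed (suc n) φ

pushed-⊣⊢ : ∀ φ → φ ⊣⊢ pushed 0 φ
pushed-⊣⊢ ⊥'      = ⇒-refl , ⇒-refl
pushed-⊣⊢ (var p) = ⇒-refl , ⇒-refl
pushed-⊣⊢ (φ ∧ ψ) = ∧-cong (pushed-⊣⊢ φ) (pushed-⊣⊢ ψ)
pushed-⊣⊢ (φ ∨ ψ) = ∨-cong (pushed-⊣⊢ φ) (pushed-⊣⊢ ψ)
pushed-⊣⊢ (φ ⇒ ψ) = ⇒-cong (pushed-⊣⊢ φ) (pushed-⊣⊢ ψ)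
pushed-⊣⊢ (○ φ)   = ⊣⊢-trans (○-cong (pushed-⊣⊢ φ)) (○-pushed 0 φ)

ITL0⊆ITLFS : ITL0 ⊢ φ → ITLFS ⊢ φ
ITL0⊆ITLFS ax-K     = ax-K
ITL0⊆ITLFS ax-S     = ax-S
ITL0⊆ITLFS ax-∧E₁   = ax-∧E₁
ITL0⊆ITLFS ax-∧E₂   = ax-∧E₂
ITL0⊆ITLFS ax-∧I    = ax-∧I
ITL0⊆ITLFS ax-∨I₁   = ax-∨I₁
ITL0⊆ITLFS ax-∨I₂   = ax-∨I₂
ITL0⊆ITLFS ax-∨E    = ax-∨E
ITL0⊆ITLFS ax-⊥E    = ax-⊥E
ITL0⊆ITLFS ax-N1    = ax-N1
ITL0⊆ITLFS ax-N2    = ax-N2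
ITL0⊆ITLFS ax-N3    = ax-N3
ITL0⊆ITLFS ax-N4    = ax-N4
ITL0⊆ITLFS (mp d e) = mp (ITL0⊆ITLFS d) (ITL0⊆ITLFS e)
ITL0⊆ITLFS (nec d)  = nec (ITL0⊆ITLFS d)

-- Unwinding an expanding poset into a persistent one

module Unwinding (E : ExpandingPoset) (𝒱 : Valuation E) where
  open ExpandingPoset E
  open Valuation 𝒱
  private module PO = IsPartialOrder isPO

  unwound : ExpandingPoset
  unwound = record
    { W    = W × ℕ
    ; _≼_  = λ (w , m) (v , n) → w ≼ v × m ≡ n
    ; isPO = record
      { isPreorder = record
        { isEquivalence = isEquivalence
        ; reflexive     = λ { refl → PO.refl , refl }
        ; trans         = λ (p , e) (q , e′) → PO.trans p q , trans e e′
        }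
      ; antisym = λ (p , e) (q , _) → cong₂ _,_ (PO.antisym p q) e
      }
    ; f    = λ (w , n) → w , suc n
    ; mono = λ (p , e) → p , cong suc e
    }

  -- The new map leaves the first coordinate alone and the order relates equal levels only, so
  -- whatever lies above an image is again an image. The dynamics of `E` moves into the valuation.
  unwound-persistent : IsPersistent unwound
  unwound-persistent {_ , n} {v , _} (p , refl) = (v , n) , (p , refl) , refl

  -- Applying `f` innermost first matches the clause of satisfaction for `○`, so `⊨○^` follows by a
  -- bare induction.
  f^ : ℕ → W → W
  f^ zero    w = w
  f^ (suc n) w = f^ n (f w)

  f^-mono : ∀ n {w v} → w ≼ v → f^ n w ≼ f^ n v
  f^-mono zero    p = p
  f^-mono (suc n) p = f^-mono n (mono p)

  -- Level n evaluates the variables n steps ahead, so that (w , n) satisfies p exactly when w satisfies ○^ n p.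
  unwoundValuation : Valuation unwound
  unwoundValuation = record
    { V      = λ p (w , n) → V p (f^ n w)
    ; upward = λ { {w = _ , n} (p , refl) → upward (f^-mono n p) }
    }

  ⊨○^ : ∀ n p w → V p (f^ n w) ≡ (E , 𝒱 ⊨ ○^ n (var p) at w)
  ⊨○^ zero    p w = refl
  ⊨○^ (suc n) p w = ⊨○^ n p (f w)

  -- At `○` the level and the index of `pushed` rise together. At an implication the level stays
  -- fixed, so the points above `(w , n)` correspond to those above `w`; the antecedent makes the
  -- two directions mutual.
  to   : ∀ φ n w → unwound , unwoundValuation ⊨ φ at (w , n) → E , 𝒱 ⊨ pushed n φ at w
  from : ∀ φ n w → E , 𝒱 ⊨ pushed n φ at w → unwound , unwoundValuation ⊨ φ at (w , n)

  to (var p) n w x        = subst (λ P → P) (⊨○^ n p w) x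
  to (φ ∧ ψ) n w (x , y)  = to φ n w x , to ψ n w y
  to (φ ∨ ψ) n w (inj₁ x) = inj₁ (to φ n w x)
  to (φ ∨ ψ) n w (inj₂ y) = inj₂ (to ψ n w y)
  to (φ ⇒ ψ) n w h v p x  = to ψ n v (h (v , n) (p , refl) (from φ n v x))
  to (○ φ)   n w x        = to φ (suc n) w x

  from (var p) n w x                   = subst (λ P → P) (sym (⊨○^ n p w)) x
  from (φ ∧ ψ) n w (x , y)             = from φ n w x , from ψ n w y
  from (φ ∨ ψ) n w (inj₁ x)            = inj₁ (from φ n w x)
  from (φ ∨ ψ) n w (inj₂ y)            = inj₂ (from ψ n w y)
  from (φ ⇒ ψ) n w h (v , _) (p , refl) x = from ψ n v (h v p (to φ n v x))
  from (○ φ)   n w x                   = from φ (suc n) w x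

pushed-valid : ∀ φ → ValidPersistent φ → ValidExpanding (pushed 0 φ)
pushed-valid φ valid E 𝒱 w = to φ 0 w (valid unwound unwound-persistent unwoundValuation (w , 0))
  where open Unwinding E 𝒱

theorem5p7 : ((φ : Fm) → ValidExpanding φ → ITL0 ⊢ φ)
    × ((φ : Fm) → ValidPersistent φ → ITLFS ⊢ φ)
theorem5p7 = completeness-ITL0
  , λ φ valid → mp (proj₂ (pushed-⊣⊢ φ)) (ITL0⊆ITLFS (completeness-ITL0 (pushed 0 φ) (pushed-valid φ valid)))
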